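{- Let $T$ be a finite tree that is an SR-graph and let $e\in E(T)$. Then $e$ is a bondage edge of $T$ if and only if one of the ends of $e$ is a leaf and the other is a strong support vertex.
   Context: $\gamma(G)$ denotes the domination number of a finite simple graph $G$. For an edge $e=uv$ of $G$, $G-e$ is the graph obtained by deleting $e$, and $G_e$ is the graph obtained by subdividing $e$: delete $e$, add a new vertex $w$ and the edges $uw$ and $wv$. A finite connected simple graph $G$ of order at least two is an SR-graph (sub-removable graph) if $\gamma(G-e)=\gamma(G_e)$ for every edge $e$ of $G$. An edge $e$ of $G$ is a bondage edge if $\gamma(G-e)>\gamma(G)$. A leaf is a vertex of degree $1$. A strong support vertex is a vertex adjacent to at least two leaves. -}

module Defs where

open import Data.Empty using (⊥)
open import Data.Fin.Base using (Fin; zero; suc; inject₁; fromℕ)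
open import Data.Fin.Properties using (_≟_; any?; all?)
open import Data.Fin.Subset using (Subset; _∈_; ∣_∣; ⊤)
open import Data.Fin.Subset.Properties using (_∈?_; ∈⊤; anySubset?)
open import Data.Nat.Base using (ℕ; suc; _≤_; _<_; _+_)
open import Data.Nat.Induction using (Acc; acc; <-wellFounded)
open import Data.Nat.Properties using (_<?_; ≮⇒≥)
open import Data.Product.Base using (∃; ∃-syntax; _×_; _,_; proj₁; proj₂)
open import Data.Sum.Base using (_⊎_; inj₁; inj₂)
open import Data.Vec.Base using (tabulate)
open import Function.Definitions using (Injective)
open import Level using (0ℓ)
open import Relation.Binary.Core using (Rel)
open import Relation.Binary.Construct.Closure.ReflexiveTransitive using (Star)
open import Relation.Binary.Definitions using (Symmetric; Decidable)
open import Relation.Binary.PropositionalEquality using (_≡_; _≢_; refl)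
open import Relation.Nullary using (¬_; Dec; yes; no)
open import Relation.Nullary.Decidable using (does; _×-dec_; _⊎-dec_; ¬?)

record Graph (n : ℕ) : Set₁ where
  field
    Adj    : Rel (Fin n) 0ℓ
    adj?   : Decidable Adj
    sym    : Symmetric Adj
    irrefl : ∀ {v} → ¬ Adj v v

open Graph public

-- An edge comes with an ordering of its two ends; none of the notions
-- below depends on that ordering.
record Edge {n : ℕ} (G : Graph n) : Set where
  field
    end₁ end₂ : Fin n
    joined    : Adj G end₁ end₂

open Edge public

module _ {n : ℕ} {G : Graph n} where

  Joins : Edge G → Rel (Fin n) 0ℓ
  Joins e x y = (x ≡ end₁ e × y ≡ end₂ e) ⊎ (x ≡ end₂ e × y ≡ end₁ e)

  joins? : ∀ e → Decidable (Joins e)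
  joins? e x y = (x ≟ end₁ e ×-dec y ≟ end₂ e) ⊎-dec (x ≟ end₂ e ×-dec y ≟ end₁ e)

  joins-sym : ∀ e → Symmetric (Joins e)
  joins-sym e (inj₁ (p , q)) = inj₂ (q , p)
  joins-sym e (inj₂ (p , q)) = inj₁ (q , p)

  IsEnd : Edge G → Fin n → Set
  IsEnd e x = x ≡ end₁ e ⊎ x ≡ end₂ e

  isEnd? : ∀ e x → Dec (IsEnd e x)
  isEnd? e x = x ≟ end₁ e ⊎-dec x ≟ end₂ e

delete : ∀ {n} (G : Graph n) → Edge G → Graph n
delete G e .Adj x y        = Adj G x y × ¬ Joins e x y
delete G e .adj? x y       = adj? G x y ×-dec ¬? (joins? e x y)
delete G e .sym (a , ¬j)   = sym G a , λ j → ¬j (joins-sym e j)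
delete G e .irrefl (a , _) = irrefl G a

-- The new vertex is zero; an old vertex x becomes suc x.
subdivide : ∀ {n} (G : Graph n) → Edge G → Graph (suc n)
subdivide {n} G e = record
  { Adj    = Adj′
  ; adj?   = adj′?
  ; sym    = λ {x} {y} → sym′ x y
  ; irrefl = λ {x} → irrefl′ x
  }
  where
  Adj′ : Rel (Fin (suc n)) 0ℓ
  Adj′ zero    zero    = ⊥
  Adj′ zero    (suc y) = IsEnd e y
  Adj′ (suc x) zero    = IsEnd e x
  Adj′ (suc x) (suc y) = Adj (delete G e) x y

  adj′? : Decidable Adj′
  adj′? zero    zero    = no λ ()
  adj′? zero    (suc y) = isEnd? e y
  adj′? (suc x) zero    = isEnd? e x
  adj′? (suc x) (suc y) = adj? (delete G e) x y

  sym′ : ∀ x y → Adj′ x y → Adj′ y x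
  sym′ zero    (suc y) a = a
  sym′ (suc x) zero    a = a
  sym′ (suc x) (suc y) a = sym (delete G e) a

  irrefl′ : ∀ x → ¬ Adj′ x x
  irrefl′ (suc x) a = irrefl (delete G e) a

module _ {n : ℕ} (G : Graph n) where

  Dominating : Subset n → Set
  Dominating S = ∀ v → v ∈ S ⊎ ∃[ u ] (u ∈ S × Adj G u v)

  dominating? : ∀ S → Dec (Dominating S)
  dominating? S = all? λ v → v ∈? S ⊎-dec any? λ u → u ∈? S ×-dec adj? G u v

  IsDominationNumber : ℕ → Set
  IsDominationNumber k =
    (∃[ S ] (Dominating S × ∣ S ∣ ≡ k)) × (∀ S → Dominating S → k ≤ ∣ S ∣)

  dominationNumber : ∃ IsDominationNumber
  dominationNumber = descend ⊤ (λ _ → inj₁ ∈⊤) (<-wellFounded ∣ ⊤ {n} ∣)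
    where
    descend : ∀ S → Dominating S → Acc _<_ ∣ S ∣ → ∃ IsDominationNumber
    descend S dom (acc rec)
      with anySubset? (λ S′ → dominating? S′ ×-dec (∣ S′ ∣ <? ∣ S ∣))
    ... | yes (S′ , dom′ , lt) = descend S′ dom′ (rec lt)
    ... | no ¬smaller =
      ∣ S ∣ , (S , dom , refl) , λ S′ dom′ → ≮⇒≥ λ lt → ¬smaller (S′ , dom′ , lt)

  γ : ℕ
  γ = proj₁ dominationNumber

  γ-isDominationNumber : IsDominationNumber γ
  γ-isDominationNumber = proj₂ dominationNumber

module _ {n : ℕ} (G : Graph n) where

  neighbours : Fin n → Subset n
  neighbours v = tabulate λ u → does (adj? G v u)

  degree : Fin n → ℕ
  degree v = ∣ neighbours v ∣

  IsLeaf : Fin n → Set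
  IsLeaf v = degree v ≡ 1

  IsStrongSupport : Fin n → Set
  IsStrongSupport v =
    ∃[ x ] ∃[ y ] (x ≢ y × (Adj G v x × IsLeaf x) × (Adj G v y × IsLeaf y))

  record IsConnected : Set where
    field
      nonempty  : 1 ≤ n
      reachable : ∀ u v → Star (Adj G) u v

  record Cycle : Set where
    field
      extra    : ℕ
      vertex   : Fin (3 + extra) → Fin n
      distinct : Injective _≡_ _≡_ vertex
      step     : ∀ i → Adj G (vertex (inject₁ i)) (vertex (suc i))
      close    : Adj G (vertex (fromℕ (2 + extra))) (vertex zero)

  record IsTree : Set where
    field
      connected : IsConnected
      acyclic   : ¬ Cycle

  record IsSRGraph : Set where
    field
      order≥2   : 2 ≤ n
      connected : IsConnected
      removable : ∀ e → γ (delete G e) ≡ γ (subdivide G e)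

  IsBondage : Edge G → Set
  IsBondage e = γ G < γ (delete G e)

{-# OPTIONS --safe #-}
module Submission where

-- For an end u of an edge uv, call u critical if the component of T - uv at u has a set
-- smaller than its domination number dominating everything but u, good if some minimum
-- dominating set of that component contains u, and bad otherwise. The SR-condition excludes
-- exactly the edges with both ends critical or both ends bad, and uv is a bondage edge
-- precisely when one end, say u, is critical and the other is good but not critical.
-- If such a u had a neighbour x other than v, then u and x would both be bad for ux, which is
-- excluded; so u is a leaf. A good non-critical v has a neighbour y other than u that is
-- critical for yv, and y is a leaf by the same argument. The sizes are compared by exchanging
-- the parts of two dominating sets of T on one side of an edge.

open import Defs hiding (sym)
open import Defs using () renaming (sym to adj-sym)
open import Data.Bool.Base using (true; false)
open import Data.Fin.Base using (Fin; zero; suc; inject₁; fromℕ)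
open import Data.Fin.Properties using (_≟_; any?; ¬∀⟶∃¬)
open import Data.Fin.Subset
open import Data.Fin.Subset.Properties
open import Data.Nat.Base using (ℕ; zero; suc; _+_; _≤_; _<_; z≤n; s≤s)
open import Data.Nat.Induction using (Acc; acc; <-wellFounded)
open import Data.Nat.Properties hiding (_≟_)
open import Data.Product.Base using (∃-syntax; _×_; _,_; proj₁; proj₂)
open import Data.Sum.Base using (_⊎_; inj₁; inj₂; [_,_]′)
open import Data.Vec.Base using ([]; _∷_; here; there; tabulate)
open import Data.Vec.Properties using (lookup∘tabulate; []=⇒lookup; lookup⇒[]=)
open import Function.Base using (_∘_; id)
open import Function.Bundles using (_⇔_; mk⇔)
open import Function.Definitions using (Injective)
open import Relation.Binary.PropositionalEquality
  using (_≡_; _≢_; refl; sym; trans; cong; cong₂; subst; subst₂)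
open import Relation.Nullary using (¬_; Dec; yes; no; contradiction)
open import Relation.Nullary.Decidable using (does; _×-dec_; _⊎-dec_; ¬?; dec-true)

-- Insertion into subsets, and exchanging two subsets on a part of the vertex set.

private variable
  n : ℕ
  i j : Fin n
  P Q B : Subset n

insert : Subset n → Fin n → Subset n
insert P x = P ∪ ⁅ x ⁆

x∈insert : i ∈ insert P i
x∈insert {i = x} {P = P} = q⊆p∪q P ⁅ x ⁆ (x∈⁅x⁆ x)

⊆insert : P ⊆ insert P i
⊆insert {i = x} = p⊆p∪q ⁅ x ⁆

insert⁻ : j ∈ insert P i → j ∈ P ⊎ j ≡ i
insert⁻ {P = P} {i = x} y∈ with x∈p∪q⁻ P ⁅ x ⁆ y∈
... | inj₁ y∈P = inj₁ y∈P
... | inj₂ y∈x = inj₂ (x∈⁅y⁆⇒x≡y x y∈x)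

∣∪∣≤ : (P Q : Subset n) → ∣ P ∪ Q ∣ ≤ ∣ P ∣ + ∣ Q ∣
∣∪∣≤ []          []          = z≤n
∣∪∣≤ (false ∷ P) (false ∷ Q) = ∣∪∣≤ P Q
∣∪∣≤ (false ∷ P) (true  ∷ Q) = ≤-trans (s≤s (∣∪∣≤ P Q)) (≤-reflexive (sym (+-suc ∣ P ∣ ∣ Q ∣)))
∣∪∣≤ (true  ∷ P) (false ∷ Q) = s≤s (∣∪∣≤ P Q)
∣∪∣≤ (true  ∷ P) (true  ∷ Q) = s≤s (≤-trans (∣∪∣≤ P Q) (+-monoʳ-≤ ∣ P ∣ (n≤1+n ∣ Q ∣)))

∣insert∣≤ : (P : Subset n) (x : Fin n) → ∣ insert P x ∣ ≤ suc ∣ P ∣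
∣insert∣≤ P x = ≤-trans (∣∪∣≤ P ⁅ x ⁆)
  (≤-reflexive (trans (cong (∣ P ∣ +_) (∣⁅x⁆∣≡1 x)) (+-comm ∣ P ∣ 1)))

∣insert∣≤-∈ : i ∈ P → ∣ insert P i ∣ ≤ ∣ P ∣
∣insert∣≤-∈ {i = x} {P = P} x∈P = p⊆q⇒∣p∣≤∣q∣ absorbed
  where
  absorbed : insert P x ⊆ P
  absorbed y∈ = [ id , (λ { refl → x∈P }) ]′ (insert⁻ {P = P} y∈)

∉-remove : i ∉ P - i
∉-remove {i = zero}  {P = true  ∷ P} ()
∉-remove {i = zero}  {P = false ∷ P} ()
∉-remove {i = suc x} {P = _ ∷ P} (there x∈) = ∉-remove {i = x} {P = P} x∈

mix : Subset n → Subset n → Subset n → Subset n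
mix A P Q = (A ∩ P) ∪ (∁ A ∩ Q)

mix-in : i ∈ B → i ∈ P → i ∈ mix B P Q
mix-in x∈A x∈P = x∈p∪q⁺ (inj₁ (x∈p∩q⁺ (x∈A , x∈P)))

mix-out : i ∉ B → i ∈ Q → i ∈ mix B P Q
mix-out x∉A x∈Q = x∈p∪q⁺ (inj₂ (x∈p∩q⁺ (x∉p⇒x∈∁p x∉A , x∈Q)))

∣∩∣-split : (A P : Subset n) → ∣ P ∣ ≡ ∣ A ∩ P ∣ + ∣ ∁ A ∩ P ∣
∣∩∣-split []          []          = refl
∣∩∣-split (false ∷ A) (false ∷ P) = ∣∩∣-split A P
∣∩∣-split (true  ∷ A) (false ∷ P) = ∣∩∣-split A P
∣∩∣-split (false ∷ A) (true  ∷ P) = trans (cong suc (∣∩∣-split A P)) (sym (+-suc _ _))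
∣∩∣-split (true  ∷ A) (true  ∷ P) = cong suc (∣∩∣-split A P)

-- The exchange trades the part of `Q` inside `A` for that of `P`. The additive form avoids
-- truncated subtraction and lets a comparison of whole sets be cancelled to one inside `A`, or the
-- reverse.
∣mix∣ : (A P Q : Subset n) → ∣ A ∩ Q ∣ + ∣ mix A P Q ∣ ≡ ∣ A ∩ P ∣ + ∣ Q ∣
∣mix∣ []          []          []          = refl
∣mix∣ (false ∷ A) (_     ∷ P) (false ∷ Q) = ∣mix∣ A P Q
∣mix∣ (false ∷ A) (_     ∷ P) (true  ∷ Q) =
  trans (+-suc _ _) (trans (cong suc (∣mix∣ A P Q)) (sym (+-suc _ _)))
∣mix∣ (true  ∷ A) (false ∷ P) (false ∷ Q) = ∣mix∣ A P Q
∣mix∣ (true  ∷ A) (true  ∷ P) (false ∷ Q) = trans (+-suc _ _) (cong suc (∣mix∣ A P Q))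
∣mix∣ (true  ∷ A) (false ∷ P) (true  ∷ Q) = trans (cong suc (∣mix∣ A P Q)) (sym (+-suc _ _))
∣mix∣ (true  ∷ A) (true  ∷ P) (true  ∷ Q) =
  cong suc (trans (+-suc _ _) (trans (cong suc (∣mix∣ A P Q)) (sym (+-suc _ _))))

module _ (A P Q : Subset n) where

  mix-larger : ∣ Q ∣ < ∣ mix A P Q ∣ → ∣ A ∩ Q ∣ < ∣ A ∩ P ∣
  mix-larger lt = +-cancelʳ-< ∣ Q ∣ _ _
    (<-≤-trans (+-monoʳ-< ∣ A ∩ Q ∣ lt) (≤-reflexive (∣mix∣ A P Q)))

  mix-≥ : ∣ Q ∣ ≤ ∣ mix A P Q ∣ → ∣ A ∩ Q ∣ ≤ ∣ A ∩ P ∣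
  mix-≥ le = +-cancelʳ-≤ ∣ Q ∣ _ _
    (≤-trans (+-monoʳ-≤ ∣ A ∩ Q ∣ le) (≤-reflexive (∣mix∣ A P Q)))

  mix-≤ : ∣ A ∩ P ∣ ≤ ∣ A ∩ Q ∣ → ∣ mix A P Q ∣ ≤ ∣ Q ∣
  mix-≤ le = +-cancelˡ-≤ ∣ A ∩ Q ∣ _ _
    (≤-trans (≤-reflexive (∣mix∣ A P Q)) (+-monoˡ-≤ ∣ Q ∣ le))

-- The two sides of an edge of an acyclic graph.

module _ (G : Graph n) where

  -- Stands for `A` being the component at `a` of a tree without the edge `ab`, reduced to what the
  -- exchange arguments use.
  record Separates (A : Subset n) (a b : Fin n) : Set where
    field
      a∈       : a ∈ A
      b∉       : b ∉ A
      crossing : ∀ {p q} → p ∈ A → q ∉ A → Adj G p q → p ≡ a × q ≡ b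

  -- Runs from `p` to the base point `a`, so that a path is extended by putting the new vertex at
  -- index zero; `size` counts edges.
  record PathWithin (A : Subset n) (a p : Fin n) : Set where
    field
      size     : ℕ
      vertex   : Fin (suc size) → Fin n
      distinct : Injective _≡_ _≡_ vertex
      within   : ∀ i → vertex i ∈ A
      step     : ∀ i → Adj G (vertex (inject₁ i)) (vertex (suc i))
      first    : vertex zero ≡ p
      last     : vertex (fromℕ size) ≡ a

  weaken-path : ∀ {A B a p} → A ⊆ B → PathWithin A a p → PathWithin B a p
  weaken-path A⊆B π = record
    { PathWithin π ; within = A⊆B ∘ PathWithin.within π }

  extend-path : ∀ {A a p q} → q ∉ A → Adj G p q → PathWithin A a p → PathWithin (insert A q) a q
  extend-path {A} {a} {p} {q} q∉A p~q π = record
    { size = suc size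
    ; vertex = vertex′
    ; distinct = distinct′
    ; within = λ { zero → x∈insert {P = A} ; (suc i) → ⊆insert (within i) }
    ; step = λ { zero → subst (Adj G q) (sym first) (adj-sym G p~q) ; (suc i) → step i }
    ; first = refl
    ; last = last
    }
    where
    open PathWithin π
    vertex′ : Fin (suc (suc size)) → Fin n
    vertex′ zero    = q
    vertex′ (suc i) = vertex i
    distinct′ : Injective _≡_ _≡_ vertex′
    distinct′ {zero}  {zero}  eq = refl
    distinct′ {zero}  {suc j} eq = contradiction (subst (_∈ A) (sym eq) (within j)) q∉A
    distinct′ {suc i} {zero}  eq = contradiction (subst (_∈ A) eq (within i)) q∉A
    distinct′ {suc i} {suc j} eq = cong suc (distinct eq)

  Closed : Subset n → Set
  Closed A = ∀ {p q} → p ∈ A → Adj G p q → q ∈ A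

  -- Each vertex enters the set last, so its path through earlier vertices is simple.
  component : ∀ a → ∃[ A ] (a ∈ A × Closed A × (∀ {p} → p ∈ A → PathWithin A a p))
  component a = grow ⁅ a ⁆ (x∈⁅x⁆ a) start (<-wellFounded _)
    where
    start : ∀ {p} → p ∈ ⁅ a ⁆ → PathWithin ⁅ a ⁆ a p
    start p∈ with refl ← x∈⁅y⁆⇒x≡y a p∈ = record
      { size = 0
      ; vertex = λ _ → a
      ; distinct = λ { {zero} {zero} _ → refl }
      ; within = λ _ → x∈⁅x⁆ a
      ; step = λ ()
      ; first = refl
      ; last = refl
      }
    grow : ∀ A → a ∈ A → (∀ {p} → p ∈ A → PathWithin A a p) → Acc _<_ ∣ ∁ A ∣ →
           ∃[ A ] (a ∈ A × Closed A × (∀ {p} → p ∈ A → PathWithin A a p))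
    grow A a∈A paths (acc rec)
      with any? (λ p → any? (λ q → p ∈? A ×-dec ¬? (q ∈? A) ×-dec adj? G p q))
    ... | yes (p , q , p∈A , q∉A , p~q) =
      grow (insert A q) (⊆insert a∈A) paths′
        (rec (p⊂q⇒∣p∣<∣q∣ (p⊂q⇒∁p⊃∁q (⊆insert , q , x∈insert {P = A} , q∉A))))
      where
      paths′ : ∀ {r} → r ∈ insert A q → PathWithin (insert A q) a r
      paths′ r∈ with insert⁻ {P = A} r∈
      ... | inj₁ r∈A  = weaken-path ⊆insert (paths r∈A)
      ... | inj₂ refl = extend-path q∉A p~q (paths p∈A)
    ... | no ¬exit = A , a∈A , closed , paths
      where
      closed : Closed A
      closed {p} {q} p∈A p~q with q ∈? A
      ... | yes q∈A = q∈A
      ... | no  q∉A = contradiction (p , q , p∈A , q∉A , p~q) ¬exit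

-- The component of `T - e` at the first end works: a path in it between the two ends would close up
-- with `e` to a cycle.
edge-separates : (T : Graph n) → ¬ Cycle T → (e : Edge T) →
  ∃[ A ] Separates T A (end₁ e) (end₂ e)
edge-separates T acyclic e with component (delete T e) (end₁ e)
... | A , a∈A , closed , paths = A , record { a∈ = a∈A ; b∉ = b∉A ; crossing = cross }
  where
  b∉A : end₂ e ∉ A
  b∉A b∈A = go (paths b∈A)
    where
    go : ¬ PathWithin (delete T e) A (end₁ e) (end₂ e)
    -- Length zero makes `e` a loop and length one uses the deleted edge; a path with `k + 2` edges
    -- gives a cycle on `k + 3` vertices.
    go record { size = 0 ; first = first ; last = last } =
      irrefl T (subst (λ w → Adj T w (end₂ e)) (trans (sym last) first) (joined e))
    go record { size = 1 ; step = step ; first = first ; last = last } =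
      proj₂ (step zero) (inj₂ (first , last))
    go record { size = suc (suc k) ; vertex = vertex ; distinct = distinct
              ; step = step ; first = first ; last = last } = acyclic record
      { extra = k
      ; vertex = vertex
      ; distinct = distinct
      ; step = proj₁ ∘ step
      ; close = subst₂′ (sym last) (sym first) (joined e)
      }
      where
      subst₂′ : ∀ {a b c d} → a ≡ c → b ≡ d → Adj T a b → Adj T c d
      subst₂′ refl refl = id
  cross : ∀ {p q} → p ∈ A → q ∉ A → Adj T p q → p ≡ end₁ e × q ≡ end₂ e
  cross {p} {q} p∈A q∉A p~q with joins? e p q
  ... | no  off                  = contradiction (closed p∈A (p~q , off)) q∉A
  ... | yes (inj₁ eqs)           = eqs
  ... | yes (inj₂ (refl , refl)) = contradiction p∈A b∉A

-- Domination of single vertices, and dominating sets of a subdivision.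

Dominated : Graph n → Subset n → Fin n → Set
Dominated G S v = v ∈ S ⊎ ∃[ u ] (u ∈ S × Adj G u v)

dominated? : (G : Graph n) (S : Subset n) (v : Fin n) → Dec (Dominated G S v)
dominated? G S v = v ∈? S ⊎-dec any? λ u → u ∈? S ×-dec adj? G u v

γ-≤ : (G : Graph n) → Dominating G P → γ G ≤ ∣ P ∣
γ-≤ {P = P} G = proj₂ (γ-isDominationNumber G) P

γ-set : (G : Graph n) → ∃[ S ] (Dominating G S × ∣ S ∣ ≡ γ G)
γ-set G = proj₁ (γ-isDominationNumber G)

-- The new vertex takes care of itself and of both ends. This bounds the domination number of the
-- subdivision by one more than the size of `P`.
subdivide-dominating : (T : Graph n) (e : Edge T) →
  (∀ {z} → z ≢ end₁ e → z ≢ end₂ e → Dominated (delete T e) P z) →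
  Dominating (subdivide T e) (inside ∷ P)
subdivide-dominating T e dom zero = inj₁ here
subdivide-dominating T e dom (suc z) with z ≟ end₁ e | z ≟ end₂ e
... | yes z≡u | _       = inj₂ (zero , here , inj₁ z≡u)
... | no _    | yes z≡v = inj₂ (zero , here , inj₂ z≡v)
... | no z≢u  | no z≢v with dom z≢u z≢v
...   | inj₁ z∈             = inj₁ (there z∈)
...   | inj₂ (p , p∈ , p~z) = inj₂ (suc p , there p∈ , p~z)

-- The new vertex reaches only the ends of `e`, so any other vertex is dominated by an old one.
subdivide-dominated : (T : Graph n) (e : Edge T) {b : Side} → Dominating (subdivide T e) (b ∷ P) →
  ∀ {z} → z ≢ end₁ e → z ≢ end₂ e → Dominated T P z
subdivide-dominated T e dom {z} z≢u z≢v with dom (suc z)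
... | inj₁ (there z∈)                        = inj₁ z∈
... | inj₂ (zero , _ , inj₁ z≡u)             = contradiction z≡u z≢u
... | inj₂ (zero , _ , inj₂ z≡v)             = contradiction z≡v z≢v
... | inj₂ (suc p , there p∈ , (p~z , _))    = inj₂ (p , p∈ , p~z)

-- Replacing the new vertex, if present, by both ends enlarges the set by at most one: when the new
-- vertex is absent, it is dominated by an end that already lies in `P`.
insert-ends-smaller : (T : Graph n) (e : Edge T) {b : Side} {S : Subset n} →
  Dominating (subdivide T e) (b ∷ P) →
  suc (suc ∣ S ∣) ≤ ∣ insert (insert P (end₁ e)) (end₂ e) ∣ → ∣ S ∣ < ∣ b ∷ P ∣
insert-ends-smaller {P = P} T e {b} {S} dom le = go b dom
  where
  u = end₁ e
  v = end₂ e
  one : ∣ insert (insert P u) v ∣ ≤ suc ∣ P ∣ → ∣ S ∣ < ∣ P ∣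
  one le′ = ≤-pred (≤-trans le le′)
  go : ∀ b → Dominating (subdivide T e) (b ∷ P) → ∣ S ∣ < ∣ b ∷ P ∣
  go true  _ = s≤s (≤-pred (≤-pred (≤-trans le
    (≤-trans (∣insert∣≤ (insert P u) v) (s≤s (∣insert∣≤ P u))))))
  go false dom with dom zero
  ... | inj₂ (suc p , there u∈ , inj₁ refl) =
    one (≤-trans (∣insert∣≤ (insert P u) v) (s≤s (∣insert∣≤-∈ u∈)))
  ... | inj₂ (suc p , there v∈ , inj₂ refl) =
    one (≤-trans (∣insert∣≤-∈ (⊆insert {P = P} v∈)) (∣insert∣≤ P u))

module _ (T : Graph n) (e : Edge T) where

  private
    u = end₁ e
    v = end₂ e

  off-end₁ : ∀ {p q} → p ≢ u → q ≢ u → ¬ Joins e p q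
  off-end₁ p≢u q≢u (inj₁ (p≡u , _)) = p≢u p≡u
  off-end₁ p≢u q≢u (inj₂ (_ , q≡u)) = q≢u q≡u

  off-end₂ : ∀ {p q} → p ≢ v → q ≢ v → ¬ Joins e p q
  off-end₂ p≢v q≢v (inj₁ (_ , q≡v)) = q≢v q≡v
  off-end₂ p≢v q≢v (inj₂ (p≡v , _)) = p≢v p≡v

∈∉⇒≢ : i ∈ P → j ∉ P → i ≢ j
∈∉⇒≢ x∈ y∉ refl = y∉ x∈

-- A critical end of an edge is a leaf when the other end is in the witness.

module _ (T : Graph n) (tree : IsTree T) (sr : IsSRGraph T) where

  open IsTree tree using (acyclic)
  open IsSRGraph sr using (removable)

  -- S witnesses that end₁ e is critical. If its neighbour x is not end₂ e, adding both ends
  -- of the edge to x to a minimum dominating set of the subdivision gives a W too large.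
  critical-end-is-leaf : (e : Edge T) (S : Subset n) →
    (∀ {z} → z ≢ end₁ e → Dominated (delete T e) S z) → end₂ e ∈ S →
    ∣ S ∣ < γ (delete T e) → ∀ {x} → Adj T (end₁ e) x → x ≡ end₂ e
  critical-end-is-leaf e S S-dom v∈S S<γ {x} u~x with x ≟ end₂ e
  ... | yes x≡v = x≡v
  ... | no  x≢v = contradiction R≤S (<⇒≱ S<R)
    where
    u = end₁ e
    v = end₂ e

    v≢u : v ≢ u
    v≢u v≡u = irrefl T (subst (Adj T u) v≡u (joined e))

    min-uv : ∀ {P} → (∀ z → Dominated (delete T e) P z) → ∣ S ∣ < ∣ P ∣
    min-uv dom = <-≤-trans S<γ (γ-≤ (delete T e) dom)

    u∉S : u ∉ S
    u∉S u∈S = <-irrefl refl (min-uv λ z → dom z)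
      where
      dom : ∀ z → Dominated (delete T e) S z
      dom z with z ≟ u
      ... | yes refl = inj₁ u∈S
      ... | no z≢u   = S-dom z≢u

    f e⁻ f⁻ : Edge T
    f  = record { end₁ = u ; end₂ = x ; joined = u~x }
    e⁻ = record { end₁ = v ; end₂ = u ; joined = adj-sym T (joined e) }
    f⁻ = record { end₁ = x ; end₂ = u ; joined = adj-sym T u~x }

    -- Deleting `f` does no harm: `v` dominates `u` along `e`, and since `u` is not in `S`, nothing
    -- was dominated from `u`.
    S-dom-f : Dominating (delete T f) S
    S-dom-f z with z ≟ u
    ... | yes refl = inj₂ (v , v∈S , adj-sym T (joined e) ,
                       λ { (inj₁ (v≡u , _)) → v≢u v≡u ; (inj₂ (v≡x , _)) → x≢v (sym v≡x) })
    ... | no z≢u with S-dom z≢u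
    ...   | inj₁ z∈S                   = inj₁ z∈S
    ...   | inj₂ (p , p∈S , (p~z , _)) = inj₂ (p , p∈S , p~z , off-end₁ T f (∈∉⇒≢ p∈S u∉S) z≢u)

    X₀ = edge-separates T acyclic f⁻
    V₀ = edge-separates T acyclic e⁻
    X V M : Subset n
    X = proj₁ X₀
    V = proj₁ V₀
    M = ∁ X ∩ ∁ V
    module X = Separates (proj₂ X₀)
    module V = Separates (proj₂ V₀)

    -- Cutting out `X` makes `X`, `V′` and `M` a partition without a proof that `V` and `X` are
    -- disjoint.
    V′ : Subset n
    V′ = ∁ X ∩ V

    V′-crossing : ∀ {p q} → p ∈ V′ → q ∉ V′ → Adj T p q → p ≡ v × q ≡ u
    V′-crossing {p} {q} p∈ q∉ p~q with x∈p∩q⁻ (∁ X) V p∈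
    ... | p∉X , p∈V with q ∈? V
    ...   | no  q∉V = V.crossing p∈V q∉V p~q
    ...   | yes q∈V with q ∈? X
    ...     | no  q∉X = contradiction (x∈p∩q⁺ (x∉p⇒x∈∁p q∉X , q∈V)) q∉
    ...     | yes q∈X with refl ← proj₂ (X.crossing q∈X (x∈∁p⇒x∉p p∉X) (adj-sym T p~q)) =
      contradiction p∈V V.b∉

    u∉V′ : u ∉ V′
    u∉V′ u∈ = V.b∉ (proj₂ (x∈p∩q⁻ (∁ X) V u∈))

    u∈M : u ∈ M
    u∈M = x∈p∩q⁺ (x∉p⇒x∈∁p X.b∉ , x∉p⇒x∈∁p V.b∉)

    v∉M : v ∉ M
    v∉M v∈ = x∈∁p⇒x∉p (proj₂ (x∈p∩q⁻ (∁ X) (∁ V) v∈)) V.a∈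

    M-crossing : ∀ {p q} → p ∈ M → q ∉ M → Adj T p q → p ≡ u
    M-crossing {p} {q} p∈ q∉ p~q with x∈p∩q⁻ (∁ X) (∁ V) p∈
    ... | p∉X , p∉V with q ∈? X | q ∈? V
    ...   | yes q∈X | _       = proj₂ (X.crossing q∈X (x∈∁p⇒x∉p p∉X) (adj-sym T p~q))
    ...   | no  _   | yes q∈V = proj₂ (V.crossing q∈V (x∈∁p⇒x∉p p∉V) (adj-sym T p~q))
    ...   | no  q∉X | no q∉V  = contradiction (x∈p∩q⁺ (x∉p⇒x∈∁p q∉X , x∉p⇒x∈∁p q∉V)) q∉

    mix-outside : ∀ {A P z} → z ∉ A → z ≢ u → (∀ {p} → p ∈ A → p ∈ S → ¬ Adj T p z) →
      Dominated (delete T e) (mix A P S) z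
    mix-outside {A} z∉A z≢u no-cross with S-dom z≢u
    ... | inj₁ z∈S             = inj₁ (mix-out z∉A z∈S)
    ... | inj₂ (p , p∈S , p~z) with p ∈? A
    ...   | yes p∈A = contradiction (proj₁ p~z) (no-cross p∈A p∈S)
    ...   | no  p∉A = inj₂ (p , mix-out p∉A p∈S , p~z)

    R⁺ = γ-set (subdivide T f)

    -- The SR-condition at `f` carries the bound from `T - f` over to the subdivision of `f`.
    R≤S : ∣ proj₁ R⁺ ∣ ≤ ∣ S ∣
    R≤S = ≤-trans (≤-reflexive (trans (proj₂ (proj₂ R⁺)) (sym (removable f))))
      (γ-≤ (delete T f) S-dom-f)

    S<R : ∣ S ∣ < ∣ proj₁ R⁺ ∣
    S<R with R⁺
    ... | b ∷ R , R-dom , _ = insert-ends-smaller T f {S = S} R-dom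
      (subst₂ _≤_ eqS (sym (split W)) sum)
      where
      W : Subset n
      W = insert (insert R u) x
      x∈W : x ∈ W
      x∈W = x∈insert {P = insert R u}
      u∈W : u ∈ W
      u∈W = ⊆insert (x∈insert {P = R})

      W-dom : ∀ {z} → z ≢ u → z ≢ x → Dominated T W z
      W-dom z≢u z≢x with subdivide-dominated T f R-dom z≢u z≢x
      ... | inj₁ z∈             = inj₁ (⊆insert (⊆insert z∈))
      ... | inj₂ (p , p∈ , p~z) = inj₂ (p , ⊆insert (⊆insert p∈) , p~z)

      -- The only vertex that `S` may miss in `T - e` is `u`, and here `x` dominates it from the
      -- side `X`.
      W-dom-X : ∀ z → Dominated (delete T e) (mix X W S) z
      W-dom-X z with z ∈? X
      ... | no  z∉X with z ≟ u
      ...   | yes refl = inj₂ (x , mix-in X.a∈ x∈W , adj-sym T u~x , off-end₂ T e x≢v (v≢u ∘ sym))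
      ...   | no  z≢u  = mix-outside z∉X z≢u λ p∈X _ p~z → z≢u (proj₂ (X.crossing p∈X z∉X p~z))
      W-dom-X z | yes z∈X with z ≟ x
      ... | yes refl = inj₁ (mix-in z∈X x∈W)
      ... | no  z≢x with W-dom (∈∉⇒≢ z∈X X.b∉) z≢x
      ...   | inj₁ z∈W             = inj₁ (mix-in z∈X z∈W)
      ...   | inj₂ (p , p∈W , p~z) with p ∈? X
      ...     | yes p∈X =
        inj₂ (p , mix-in p∈X p∈W , p~z , off-end₁ T e (∈∉⇒≢ p∈X X.b∉) (∈∉⇒≢ z∈X X.b∉))
      ...     | no  p∉X = contradiction (proj₁ (X.crossing z∈X p∉X (adj-sym T p~z))) z≢x

      -- Here `u` itself enters the set. Edges leave `M` only at `u`, which is not in `S`, so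
      -- outside `M` the old domination survives.
      W-dom-M : ∀ z → Dominated (delete T e) (mix M W S) z
      W-dom-M z with z ∈? M
      ... | no  z∉M = mix-outside z∉M (λ { refl → z∉M u∈M }) λ { p∈M p∈S p~z →
                        u∉S (subst (_∈ S) (M-crossing p∈M z∉M p~z) p∈S) }
      ... | yes z∈M with z ≟ u
      ...   | yes refl = inj₁ (mix-in z∈M u∈W)
      ...   | no  z≢u with W-dom z≢u (λ { refl → x∈∁p⇒x∉p (proj₁ (x∈p∩q⁻ (∁ X) (∁ V) z∈M)) X.a∈ })
      ...     | inj₁ z∈W             = inj₁ (mix-in z∈M z∈W)
      ...     | inj₂ (p , p∈W , p~z) with p ∈? M
      ...       | yes p∈M =
        inj₂ (p , mix-in p∈M p∈W , p~z , off-end₂ T e (∈∉⇒≢ p∈M v∉M) (∈∉⇒≢ z∈M v∉M))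
      ...       | no  p∉M = contradiction (M-crossing z∈M p∉M (adj-sym T p~z)) z≢u

      -- Both ends of `e` are left to the new vertex of the subdivision of `e`.
      W-dom-V : ∀ {z} → z ≢ u → z ≢ v → Dominated (delete T e) (mix V′ W S) z
      W-dom-V {z} z≢u z≢v with z ∈? V′
      ... | no  z∉V = mix-outside z∉V z≢u λ p∈V _ p~z → z≢u (proj₂ (V′-crossing p∈V z∉V p~z))
      ... | yes z∈V with W-dom z≢u (λ { refl → x∈∁p⇒x∉p (proj₁ (x∈p∩q⁻ (∁ X) V z∈V)) X.a∈ })
      ...   | inj₁ z∈W             = inj₁ (mix-in z∈V z∈W)
      ...   | inj₂ (p , p∈W , p~z) with p ∈? V′
      ...     | yes p∈V = inj₂ (p , mix-in p∈V p∈W , p~z , off-end₁ T e (∈∉⇒≢ p∈V u∉V′) z≢u)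
      ...     | no  p∉V = contradiction (proj₁ (V′-crossing z∈V p∉V (adj-sym T p~z))) z≢v

      -- For the sides of x and u this says that neither end of ux is good; for V′, that v is
      -- not critical.
      hX : ∣ X ∩ S ∣ < ∣ X ∩ W ∣
      hX = mix-larger X W S (min-uv W-dom-X)
      hM : ∣ M ∩ S ∣ < ∣ M ∩ W ∣
      hM = mix-larger M W S (min-uv W-dom-M)
      hV : ∣ V′ ∩ S ∣ ≤ ∣ V′ ∩ W ∣
      hV = mix-≥ V′ W S (≤-pred (<-≤-trans S<γ (≤-trans (≤-reflexive (removable e))
             (γ-≤ (subdivide T e) (subdivide-dominating T e W-dom-V)))))

      split : ∀ P → ∣ P ∣ ≡ ∣ X ∩ P ∣ + (∣ V′ ∩ P ∣ + ∣ M ∩ P ∣)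
      split P = trans (∣∩∣-split X P) (cong (∣ X ∩ P ∣ +_) (trans (∣∩∣-split V (∁ X ∩ P))
        (cong₂ (λ A A′ → ∣ A ∣ + ∣ A′ ∣) (swap V) (swap (∁ V)))))
        where
        swap : ∀ A → A ∩ (∁ X ∩ P) ≡ (∁ X ∩ A) ∩ P
        swap A = trans (sym (∩-assoc A (∁ X) P)) (cong (_∩ P) (∩-comm A (∁ X)))

      -- The two strict inequalities supply the two extra vertices that `insert-ends-smaller` asks
      -- for.
      sum : suc ∣ X ∩ S ∣ + (∣ V′ ∩ S ∣ + suc ∣ M ∩ S ∣) ≤ ∣ X ∩ W ∣ + (∣ V′ ∩ W ∣ + ∣ M ∩ W ∣)
      sum = +-mono-≤ hX (+-mono-≤ hV hM)

      eqS : suc ∣ X ∩ S ∣ + (∣ V′ ∩ S ∣ + suc ∣ M ∩ S ∣) ≡ suc (suc ∣ S ∣)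
      eqS = cong suc (trans (cong (∣ X ∩ S ∣ +_) (+-suc ∣ V′ ∩ S ∣ ∣ M ∩ S ∣))
        (trans (+-suc ∣ X ∩ S ∣ _) (cong suc (sym (split S)))))

-- Leaves and trading a leaf for its neighbour.

module _ {Pr : Fin n → Set} (Pr? : ∀ z → Dec (Pr z)) where

  ∈-tabulate⁺ : ∀ {z} → Pr z → z ∈ tabulate (does ∘ Pr?)
  ∈-tabulate⁺ {z} pz = lookup⇒[]= z _ (trans (lookup∘tabulate (does ∘ Pr?) z) (dec-true (Pr? z) pz))

  ∈-tabulate⁻ : ∀ {z} → z ∈ tabulate (does ∘ Pr?) → Pr z
  ∈-tabulate⁻ {z} z∈ with Pr? z | trans (sym (lookup∘tabulate (does ∘ Pr?) z)) ([]=⇒lookup z∈)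
  ... | yes pz | _ = pz

module _ (T : Graph n) {u v : Fin n} (u~v : Adj T u v) where

  only-neighbour⇒leaf : (∀ {x} → Adj T u x → x ≡ v) → IsLeaf T u
  only-neighbour⇒leaf only = trans (cong ∣_∣ (⊆-antisym ⊆v v⊆)) (∣⁅x⁆∣≡1 v)
    where
    ⊆v : neighbours T u ⊆ ⁅ v ⁆
    ⊆v z∈ = subst (_∈ ⁅ v ⁆) (sym (only (∈-tabulate⁻ (adj? T u) z∈))) (x∈⁅x⁆ v)
    v⊆ : ⁅ v ⁆ ⊆ neighbours T u
    v⊆ z∈ with refl ← x∈⁅y⁆⇒x≡y v z∈ = ∈-tabulate⁺ (adj? T u) u~v

  leaf⇒only-neighbour : IsLeaf T u → ∀ {x} → Adj T u x → x ≡ v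
  leaf⇒only-neighbour leaf {x} u~x with x ≟ v
  ... | yes x≡v = x≡v
  ... | no  x≢v = contradiction two (<⇒≱ (s≤s (≤-reflexive leaf)))
    where
    N = neighbours T u
    x⊆ : ⁅ x ⁆ ⊆ N - v
    x⊆ z∈ with refl ← x∈⁅y⁆⇒x≡y x z∈ = x∈p∧x≢y⇒x∈p-y (∈-tabulate⁺ (adj? T u) u~x) x≢v
    two : 2 ≤ ∣ N ∣
    two = ≤-trans (s≤s (≤-trans (≤-reflexive (sym (∣⁅x⁆∣≡1 x))) (p⊆q⇒∣p∣≤∣q∣ x⊆)))
            (x∈p⇒∣p-x∣<∣p∣ (∈-tabulate⁺ (adj? T u) u~v))

-- For a dominating `S`, the vertices that depend on `v`; their number is the measure that decreases
-- in the search for a second leaf.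
undominatedWithout : Graph n → Fin n → Subset n → Subset n
undominatedWithout G v S = tabulate λ z → does (¬? (dominated? G (S - v) z))

-- u is dominated by v alone, so one of u and v belongs to F and can be traded for v.
swap-leaf : (G : Graph n) {u v : Fin n} (F : Subset n) → Dominating G F → Adj G v u →
  (∀ {x} → Adj G u x → x ≡ v) →
  Dominating G (insert (F - u) v) × ∣ insert (F - u) v ∣ ≤ ∣ F ∣
swap-leaf {n} G {u} {v} F F-dom v~u only = dom , size
  where
  F′ : Subset n
  F′ = insert (F - u) v
  dom : Dominating G F′
  dom z with z ≟ u | z ≟ v
  ... | yes refl | _        = inj₂ (v , x∈insert {P = F - u} , v~u)
  ... | no _     | yes refl = inj₁ (x∈insert {P = F - u})
  ... | no z≢u   | no z≢v with F-dom z
  ...   | inj₁ z∈F             = inj₁ (⊆insert (x∈p∧x≢y⇒x∈p-y z∈F z≢u))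
  ...   | inj₂ (p , p∈F , p~z) =
    inj₂ (p , ⊆insert (x∈p∧x≢y⇒x∈p-y p∈F λ { refl → z≢v (only p~z) }) , p~z)
  v≢u : v ≢ u
  v≢u v≡u = irrefl G (subst (Adj G v) (sym v≡u) v~u)
  size : ∣ F′ ∣ ≤ ∣ F ∣
  size with F-dom u
  ... | inj₁ u∈F = ≤-trans (∣insert∣≤ (F - u) v) (x∈p⇒∣p-x∣<∣p∣ u∈F)
  ... | inj₂ (p , p∈F , p~u) with refl ← only (adj-sym G p~u) =
    ≤-trans (∣insert∣≤-∈ (x∈p∧x≢y⇒x∈p-y p∈F v≢u)) (∣p─q∣≤∣p∣ F ⁅ u ⁆)

-- A second leaf at the support end of a bondage edge.

module _ (T : Graph n) (tree : IsTree T) (sr : IsSRGraph T) where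

  open IsTree tree using (acyclic)
  open IsSRGraph sr using (removable)

  module _ (e : Edge T) (bondage : IsBondage T e)
           (only : ∀ {x} → Adj T (end₁ e) x → x ≡ end₂ e) where

    private
      u = end₁ e
      v = end₂ e
      v~u : Adj T v u
      v~u = adj-sym T (joined e)
      v≢u : v ≢ u
      v≢u v≡u = irrefl T (subst (Adj T u) v≡u (joined e))

    -- Otherwise `S - v` with the new vertex would dominate the subdivision of `e` using at most
    -- `γ T` vertices, although the SR-condition and bondage make that number too small.
    private-neighbour : (S : Subset n) → v ∈ S → ∣ S ∣ ≤ γ T →
      ∃[ y ] (y ≢ u × y ≢ v × ¬ Dominated T (S - v) y)
    private-neighbour S v∈S S≤γ with ¬∀⟶∃¬ _ Good good? not-all
      where
      Good : Fin n → Set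
      Good z = z ≡ u ⊎ z ≡ v ⊎ Dominated T (S - v) z
      good? : ∀ z → Dec (Good z)
      good? z = z ≟ u ⊎-dec z ≟ v ⊎-dec dominated? T (S - v) z
      not-all : ¬ (∀ z → Good z)
      not-all all = <⇒≱ (<-≤-trans bondage (≤-trans (≤-reflexive (removable e))
        (≤-trans (γ-≤ (subdivide T e) (subdivide-dominating T e dom)) (x∈p⇒∣p-x∣<∣p∣ v∈S)))) S≤γ
        where
        dom : ∀ {z} → z ≢ u → z ≢ v → Dominated (delete T e) (S - v) z
        dom {z} z≢u z≢v with all z
        ... | inj₁ z≡u                = contradiction z≡u z≢u
        ... | inj₂ (inj₁ z≡v)         = contradiction z≡v z≢v
        ... | inj₂ (inj₂ (inj₁ z∈))   = inj₁ z∈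
        ... | inj₂ (inj₂ (inj₂ (p , p∈ , p~z))) =
          inj₂ (p , p∈ , p~z , off-end₂ T e (∈∉⇒≢ p∈ (∉-remove {i = v} {P = S})) z≢v)
    ... | y , bad = y , bad ∘ inj₁ , bad ∘ inj₂ ∘ inj₁ , bad ∘ inj₂ ∘ inj₂

    -- y is dominated by v alone. Unless y is critical for yv, S can be changed on the side of y
    -- so as to dominate y without v, and fewer vertices depend on v.
    other-leaf : (S : Subset n) → Dominating T S → v ∈ S → ∣ S ∣ ≤ γ T →
      Acc _<_ ∣ undominatedWithout T v S ∣ →
      ∃[ y ] (y ≢ u × Adj T v y × (∀ {x} → Adj T y x → x ≡ v))
    other-leaf S S-dom v∈S S≤γ (acc rec) with private-neighbour S v∈S S≤γ
    ... | y , y≢u , y≢v , y-private = go (γ T <? γ (delete T f))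
      where
      y∉S : y ∉ S
      y∉S y∈S = y-private (inj₁ (x∈p∧x≢y⇒x∈p-y y∈S y≢v))

      v~y : Adj T v y
      v~y with S-dom y
      ... | inj₁ y∈S = contradiction y∈S y∉S
      ... | inj₂ (p , p∈S , p~y) with p ≟ v
      ...   | yes refl = p~y
      ...   | no  p≢v  = contradiction (inj₂ (p , x∈p∧x≢y⇒x∈p-y p∈S p≢v , p~y)) y-private

      f : Edge T
      f = record { end₁ = y ; end₂ = v ; joined = adj-sym T v~y }

      S-dom-f : ∀ {z} → z ≢ y → Dominated (delete T f) S z
      S-dom-f {z} z≢y with S-dom z
      ... | inj₁ z∈S             = inj₁ z∈S
      ... | inj₂ (p , p∈S , p~z) = inj₂ (p , p∈S , p~z , off-end₁ T f (∈∉⇒≢ p∈S y∉S) z≢y)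

      go : Dec (γ T < γ (delete T f)) → ∃[ y ] (y ≢ u × Adj T v y × (∀ {x} → Adj T y x → x ≡ v))
      -- In `T - f` the set `S` misses at most `y` and is smaller than the domination number, so `y`
      -- is critical for `f`.
      go (yes bondage-f) = y , y≢u , v~y ,
        critical-end-is-leaf T tree sr f S S-dom-f v∈S (≤-<-trans S≤γ bondage-f)
      go (no ¬bondage-f) = other-leaf S′ S′-dom v∈S′ (≤-trans S′≤S S≤γ) (rec fewer)
        where
        F₀ = γ-set (delete T f)
        -- The leaf `u` still hangs on `v` in `T - f`, so a minimum dominating set may be taken to
        -- contain `v`.
        swapped = swap-leaf (delete T f) {u} {v} (proj₁ F₀) (proj₁ (proj₂ F₀))
          (v~u , off-end₁ T f (y≢v ∘ sym) (y≢u ∘ sym)) (only ∘ proj₁)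
        F : Subset n
        F = insert (proj₁ F₀ - u) v
        v∈F : v ∈ F
        v∈F = x∈insert {P = proj₁ F₀ - u}
        F-dom : Dominating (delete T f) F
        F-dom = proj₁ swapped
        F≤γ : ∣ F ∣ ≤ γ T
        F≤γ = ≤-trans (proj₂ swapped) (≤-trans (≤-reflexive (proj₂ (proj₂ F₀))) (≮⇒≥ ¬bondage-f))

        side = edge-separates T acyclic f
        A : Subset n
        A = proj₁ side
        open Separates (proj₂ side)

        S′ : Subset n
        S′ = mix A F S
        v∈S′ : v ∈ S′
        v∈S′ = mix-out b∉ v∈S

        F-dom-A : ∀ {z} → z ∈ A → z ∈ F ⊎ ∃[ p ] (p ∈ A × p ∈ F × Adj T p z)
        F-dom-A {z} z∈A with F-dom z
        ... | inj₁ z∈F = inj₁ z∈F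
        ... | inj₂ (p , p∈F , p~z , off) with p ∈? A
        ...   | yes p∈A = inj₂ (p , p∈A , p∈F , p~z)
        ...   | no  p∉A with refl , refl ← crossing z∈A p∉A (adj-sym T p~z) =
          contradiction (inj₂ (refl , refl)) off

        -- The opposite exchange serves only to compare sizes: it dominates `T` and `F` has at most
        -- `γ T` vertices, so `F` is no larger than `S` on `A`.
        exchange-dom : Dominating T (mix A S F)
        exchange-dom z with z ∈? A
        exchange-dom z | yes z∈A with S-dom z
        ... | inj₁ z∈S = inj₁ (mix-in z∈A z∈S)
        ... | inj₂ (p , p∈S , p~z) with p ∈? A
        ...   | yes p∈A = inj₂ (p , mix-in p∈A p∈S , p~z)
        ...   | no  p∉A with refl , refl ← crossing z∈A p∉A (adj-sym T p~z) =
          inj₂ (v , mix-out b∉ v∈F , v~y)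
        exchange-dom z | no z∉A with F-dom z
        ... | inj₁ z∈F = inj₁ (mix-out z∉A z∈F)
        ... | inj₂ (p , p∈F , p~z , off) with p ∈? A
        ...   | yes p∈A = contradiction (inj₁ (crossing p∈A z∉A p~z)) off
        ...   | no  p∉A = inj₂ (p , mix-out p∉A p∈F , p~z)

        S′≤S : ∣ S′ ∣ ≤ ∣ S ∣
        S′≤S = mix-≤ A F S (mix-≥ A S F (≤-trans F≤γ (γ-≤ T exchange-dom)))

        S′-dom : Dominating T S′
        S′-dom z with z ∈? A
        S′-dom z | yes z∈A with F-dom-A z∈A
        ... | inj₁ z∈F                   = inj₁ (mix-in z∈A z∈F)
        ... | inj₂ (p , p∈A , p∈F , p~z) = inj₂ (p , mix-in p∈A p∈F , p~z)
        S′-dom z | no z∉A with S-dom z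
        ... | inj₁ z∈S = inj₁ (mix-out z∉A z∈S)
        ... | inj₂ (p , p∈S , p~z) with p ∈? A
        ...   | yes p∈A = contradiction (subst (_∈ S) (proj₁ (crossing p∈A z∉A p~z)) p∈S) y∉S
        ...   | no  p∉A = inj₂ (p , mix-out p∉A p∈S , p~z)

        -- With `f` deleted, `F` dominates `A` from within, and `v` lies outside `A`; so nothing in
        -- `A`, in particular not `y`, depends on `v` any longer.
        without-A : ∀ {z} → z ∈ A → Dominated T (S′ - v) z
        without-A z∈A with F-dom-A z∈A
        ... | inj₁ z∈F                   = inj₁ (x∈p∧x≢y⇒x∈p-y (mix-in z∈A z∈F) (∈∉⇒≢ z∈A b∉))
        ... | inj₂ (p , p∈A , p∈F , p~z) =
          inj₂ (p , x∈p∧x≢y⇒x∈p-y (mix-in p∈A p∈F) (∈∉⇒≢ p∈A b∉) , p~z)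

        -- No new dependence arises outside `A`: only `y` has a neighbour across, and `y` is not in
        -- `S`.
        without : ∀ {z} → Dominated T (S - v) z → Dominated T (S′ - v) z
        without {z} d with z ∈? A
        without d | yes z∈A = without-A z∈A
        without (inj₁ z∈) | no z∉A = inj₁ (x∈p∧x≢y⇒x∈p-y
          (mix-out z∉A (p─q⊆p S ⁅ v ⁆ z∈)) (∈∉⇒≢ z∈ (∉-remove {i = v} {P = S})))
        without (inj₂ (p , p∈ , p~z)) | no z∉A with p ∈? A
        ... | yes p∈A = contradiction
          (subst (_∈ S) (proj₁ (crossing p∈A z∉A p~z)) (p─q⊆p S ⁅ v ⁆ p∈)) y∉S
        ... | no  p∉A = inj₂ (p , x∈p∧x≢y⇒x∈p-y
          (mix-out p∉A (p─q⊆p S ⁅ v ⁆ p∈)) (∈∉⇒≢ p∈ (∉-remove {i = v} {P = S})) , p~z)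

        fewer : ∣ undominatedWithout T v S′ ∣ < ∣ undominatedWithout T v S ∣
        fewer = p⊂q⇒∣p∣<∣q∣
          ( (λ z∈ → ∈-tabulate⁺ U? (∈-tabulate⁻ U′? z∈ ∘ without))
          , y , ∈-tabulate⁺ U? y-private , λ y∈ → ∈-tabulate⁻ U′? y∈ (without-A a∈))
          where
          U? = λ z → ¬? (dominated? T (S - v) z)
          U′? = λ z → ¬? (dominated? T (S′ - v) z)

  -- As `u` is not in `S`, deleting `e` can leave only `u` undominated, and `S` is smaller than the
  -- domination number of `T - e`; so `u` is critical and hence a leaf.
  bondage-end : (e : Edge T) → IsBondage T e → (S : Subset n) → Dominating T S → ∣ S ∣ ≡ γ T →
    end₂ e ∈ S → end₁ e ∉ S → IsLeaf T (end₁ e) × IsStrongSupport T (end₂ e)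
  bondage-end e bondage S S-dom S≡γ v∈S u∉S =
    u-leaf , u , y , (λ u≡y → y≢u (sym u≡y)) , (adj-sym T (joined e) , u-leaf) ,
    (v~y , only-neighbour⇒leaf T (adj-sym T v~y) y-only)
    where
    u = end₁ e
    dom : ∀ {z} → z ≢ u → Dominated (delete T e) S z
    dom {z} z≢u with S-dom z
    ... | inj₁ z∈S             = inj₁ z∈S
    ... | inj₂ (p , p∈S , p~z) = inj₂ (p , p∈S , p~z , off-end₁ T e (∈∉⇒≢ p∈S u∉S) z≢u)
    only : ∀ {x} → Adj T u x → x ≡ end₂ e
    only = critical-end-is-leaf T tree sr e S dom v∈S (≤-<-trans (≤-reflexive S≡γ) bondage)
    u-leaf = only-neighbour⇒leaf T (joined e) only
    other = other-leaf e bondage only S S-dom v∈S (≤-reflexive S≡γ) (<-wellFounded _)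
    y   = proj₁ other
    y≢u = proj₁ (proj₂ other)
    v~y = proj₁ (proj₂ (proj₂ other))
    y-only = proj₂ (proj₂ (proj₂ other))

-- Reversing an edge, and the converse implication.

module _ (G : Graph n) where

  reverse : Edge G → Edge G
  reverse e = record { end₁ = end₂ e ; end₂ = end₁ e ; joined = adj-sym G (joined e) }

  -- The two deletions are different terms with equivalent adjacency, so a minimum dominating set is
  -- carried from one to the other.
  reverse-bondage : (e : Edge G) → IsBondage G e → IsBondage G (reverse e)
  reverse-bondage e bondage with γ-set (delete G (reverse e))
  ... | S , S-dom , S≡γ = <-≤-trans bondage (≤-trans (γ-≤ (delete G e) dom) (≤-reflexive S≡γ))
    where
    swap : ∀ {p q} → Joins e p q → Joins (reverse e) p q
    swap (inj₁ j) = inj₂ j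
    swap (inj₂ j) = inj₁ j
    dom : Dominating (delete G e) S
    dom z with S-dom z
    ... | inj₁ z∈S                   = inj₁ z∈S
    ... | inj₂ (p , p∈S , p~z , off) = inj₂ (p , p∈S , p~z , off ∘ swap)

  pendant-strong-support⇒bondage : (e : Edge G) →
    IsLeaf G (end₁ e) → IsStrongSupport G (end₂ e) → IsBondage G e
  pendant-strong-support⇒bondage e u-leaf (x₁ , x₂ , x₁≢x₂ , l₁ , l₂) = go (end₁ e ≟ x₁)
    where
    u = end₁ e
    v = end₂ e
    v~u = adj-sym G (joined e)
    v≢u : v ≢ u
    v≢u v≡u = irrefl G (subst (Adj G u) v≡u (joined e))
    u-only : ∀ {x} → Adj G u x → x ≡ v
    u-only = leaf⇒only-neighbour G (joined e) u-leaf
    u-isolated : ∀ {x} → ¬ Adj (delete G e) u x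
    u-isolated (u~x , off) = off (inj₁ (refl , u-only u~x))

    with-other-leaf : ∀ y → y ≢ u → Adj G v y → IsLeaf G y → IsBondage G e
    with-other-leaf y y≢u v~y y-leaf with γ-set (delete G e)
    ... | R , R-dom , R≡γ = <-≤-trans smaller (≤-reflexive R≡γ)
      where
      v~y-off = v~y , off-end₁ G e v≢u y≢u
      swapped = swap-leaf (delete G e) {y} {v} R R-dom v~y-off
        (leaf⇒only-neighbour G (adj-sym G v~y) y-leaf ∘ proj₁)
      W : Subset n
      W = insert (R - y) v
      v∈W : v ∈ W
      v∈W = x∈insert {P = R - y}
      u∈W : u ∈ W
      u∈W with proj₁ swapped u
      ... | inj₁ u∈W           = u∈W
      ... | inj₂ (p , _ , p~u) = contradiction (adj-sym (delete G e) {p} {u} p~u) u-isolated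
      dom : Dominating G (W - u)
      dom z with z ≟ u
      ... | yes refl = inj₂ (v , x∈p∧x≢y⇒x∈p-y v∈W v≢u , v~u)
      ... | no  z≢u with proj₁ swapped z
      ...   | inj₁ z∈W             = inj₁ (x∈p∧x≢y⇒x∈p-y z∈W z≢u)
      ...   | inj₂ (p , p∈W , p~z) =
        inj₂ (p , x∈p∧x≢y⇒x∈p-y p∈W (λ { refl → u-isolated p~z }) , proj₁ p~z)
      smaller : γ G < ∣ R ∣
      smaller = <-≤-trans (≤-<-trans (γ-≤ G dom) (x∈p⇒∣p-x∣<∣p∣ u∈W)) (proj₂ swapped)

    -- Of two distinct leaves at `v`, one differs from `u`.
    go : Dec (u ≡ x₁) → IsBondage G e
    go (no  u≢x₁) = with-other-leaf x₁ (u≢x₁ ∘ sym) (proj₁ l₁) (proj₂ l₁)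
    go (yes u≡x₁) =
      with-other-leaf x₂ (λ x₂≡u → x₁≢x₂ (sym (trans x₂≡u u≡x₁))) (proj₁ l₂) (proj₂ l₂)

-- The equivalence, with the critical end read off a minimum dominating set.

theorem9 : ∀ {n : ℕ} (T : Graph n) → IsTree T → IsSRGraph T → (e : Edge T) →
    IsBondage T e ⇔
    ((IsLeaf T (end₁ e) × IsStrongSupport T (end₂ e)) ⊎
    (IsLeaf T (end₂ e) × IsStrongSupport T (end₁ e)))
theorem9 T tree sr e = mk⇔ to
  [ (λ (l , s) → pendant-strong-support⇒bondage T e l s)
  , (λ (l , s) →
      reverse-bondage T (reverse T e) (pendant-strong-support⇒bondage T (reverse T e) l s)) ]′
  where
  to : IsBondage T e →
       (IsLeaf T (end₁ e) × IsStrongSupport T (end₂ e)) ⊎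
       (IsLeaf T (end₂ e) × IsStrongSupport T (end₁ e))
  to bondage with γ-set T
  ... | S , S-dom , S≡γ = go (end₁ e ∈? S) (end₂ e ∈? S)
    where
    -- If `S` contained both ends or neither, it would still dominate after `e` is deleted, against
    -- bondage.
    not-both-or-neither : (end₁ e ∈ S → end₂ e ∈ S) → ¬ (end₂ e ∈ S → end₁ e ∈ S)
    not-both-or-neither u⇒v v⇒u =
      contradiction (γ-≤ (delete T e) dom) (<⇒≱ (≤-<-trans (≤-reflexive S≡γ) bondage))
      where
      dom : Dominating (delete T e) S
      dom z with S-dom z
      ... | inj₁ z∈S = inj₁ z∈S
      ... | inj₂ (p , p∈S , p~z) with joins? e p z
      ...   | no  off                  = inj₂ (p , p∈S , p~z , off)
      ...   | yes (inj₁ (refl , refl)) = inj₁ (u⇒v p∈S)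
      ...   | yes (inj₂ (refl , refl)) = inj₁ (v⇒u p∈S)
    go : Dec (end₁ e ∈ S) → Dec (end₂ e ∈ S) →
         (IsLeaf T (end₁ e) × IsStrongSupport T (end₂ e)) ⊎
         (IsLeaf T (end₂ e) × IsStrongSupport T (end₁ e))
    go (no  u∉S) (yes v∈S) = inj₁ (bondage-end T tree sr e bondage S S-dom S≡γ v∈S u∉S)
    go (yes u∈S) (no  v∉S) = inj₂ (bondage-end T tree sr (reverse T e)
                               (reverse-bondage T e bondage) S S-dom S≡γ u∈S v∉S)
    go (yes u∈S) (yes v∈S) = contradiction (λ _ → u∈S) (not-both-or-neither λ _ → v∈S)
    go (no  u∉S) (no  v∉S) =
      contradiction (λ v∈S → contradiction v∈S v∉S)
        (not-both-or-neither λ u∈S → contradiction u∈S u∉S)
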